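{- Let $\mathcal{F}$ be a union-closed family of finite sets with $\emptyset\in\mathcal{F}$, let $U\subseteq\bigcup\mathcal{F}$, and let $D$ be a finite set with $D\supseteq\bigcup\mathcal{F}$. There exists an extension $\mathcal{F}'=\mathcal{F}\vee\mathcal{H}$ of $(\mathcal{F},U)$ such that (i) $\mathcal{H}$ is a nonempty order filter (up-set) of $2^{D\setminus U}$; (ii) $\mathcal{F}'_{\setminus U}=\mathcal{H}$; (iii) $\mathcal{F}'$ minimizes $\mu$ in $D$; (iv) $\mathcal{F}'_{\setminus N^2}=\{D\setminus N^2\}$.
   Context: For families $\mathcal{A},\mathcal{B}$ of sets, $\mathcal{A}\vee\mathcal{B}=\{A\cup B:A\in\mathcal{A},B\in\mathcal{B}\}$, and $\mathcal{A}_{\setminus Z}=\{A\setminus Z:A\in\mathcal{A}\}$. $J(\mathcal{F})$ is the set of union generators of $\mathcal{F}$ (nonempty $V\in\mathcal{F}$ not equal to the union of the members of $\mathcal{F}$ properly contained in $V$). For a set $X$, $N_{\mathcal{F}}(X)=X\cup\bigcup\{V\in J(\mathcal{F}):V\cap X\neq\emptyset\}$; $N=N_{\mathcal{F}}(U)$ and $N^2=N_{\mathcal{F}}(N)$. $\pi_{\mathcal{F}}(X)=\bigcup\{V\in\mathcal{F}:V\subseteq X\}$. A union-closed family $\mathcal{F}'$ is an extension of $(\mathcal{F},U)$ if $\mathcal{F}'=\mathcal{F}\vee\mathcal{H}$ for a nonempty union-closed family $\mathcal{H}$ with $(\bigcup\mathcal{H})\cap U=\emptyset$. For $X$ with $X\cap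 U=\emptyset$, $E(X)$ is the set of $Y\subseteq U$ with $\pi_{\mathcal{F}}(X\cup Y)\cap U=Y$ and $\pi_{\mathcal{F}}(X\cup Y)\supseteq\pi_{\mathcal{F}}(X\cup U)\setminus U$. For an extension $\mathcal{F}'$, $\mu_{\mathcal{F}'}=\sum_{X\in\mathcal{F}'_{\setminus U}}|E(X)|\,/\,|\mathcal{F}'_{\setminus U}|$. An extension $\mathcal{F}'$ minimizes $\mu$ in $D$ if $\bigcup\mathcal{F}'\subseteq D$ and $\mu_{\mathcal{F}'}\le\mu_{\mathcal{F}''}$ for every extension $\mathcal{F}''$ of $(\mathcal{F},U)$ with $\bigcup\mathcal{F}''\subseteq D$. -}

module Defs where

open import Data.Nat using (ℕ; zero; suc)
open import Data.Bool using (Bool; true; false; _∧_; not; if_then_else_)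
import Data.Bool as Bool
open import Data.List using (List; []; _∷_; _++_; map; foldr; filterᵇ; length)
open import Data.Bool.ListAction using (any)
open import Data.Nat.ListAction using (sum)
open import Data.Vec using (Vec; []; _∷_)
open import Data.Vec.Properties using (≡-dec)
open import Data.Fin.Subset using (Subset; ⊥; _∪_; _∩_; _─_; ∣_∣; _⊆_)
open import Data.Fin.Subset.Properties using (_⊆?_)
open import Data.Integer using (+_)
open import Data.Rational using (ℚ; 0ℚ; _/_)
open import Relation.Nullary.Decidable using (⌊_⌋)
open import Relation.Binary.PropositionalEquality using (_≡_)

-- All sets live inside the finite ambient set Fin n.
-- A family of subsets of Fin n is given by its (computable) characteristic function.
Family : ℕ → Set
Family n = Subset n → Bool

allSubsets : ∀ n → List (Subset n)
allSubsets zero = [] ∷ []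
allSubsets (suc n) = map (true ∷_) (allSubsets n) ++ map (false ∷_) (allSubsets n)

module _ {n : ℕ} where

  infix 4 _==_ _⊆ᵇ_
  _==_ : Subset n → Subset n → Bool
  A == B = ⌊ ≡-dec Bool._≟_ A B ⌋

  _⊆ᵇ_ : Subset n → Subset n → Bool
  A ⊆ᵇ B = ⌊ A ⊆? B ⌋

  isEmpty : Subset n → Bool
  isEmpty A = A == ⊥

  members : Family n → List (Subset n)
  members F = filterᵇ F (allSubsets n)

  card : Family n → ℕ
  card F = length (members F)

  ⋃ˡ : List (Subset n) → Subset n
  ⋃ˡ = foldr _∪_ ⊥

  ⋃ : Family n → Subset n
  ⋃ F = ⋃ˡ (members F)

  _∨_ : Family n → Family n → Family n
  (F ∨ H) C = any (λ A → any (λ B → (A ∪ B) == C) (members H)) (members F)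

  _∖_ : Family n → Subset n → Family n
  (F ∖ Z) C = any (λ A → (A ─ Z) == C) (members F)

  J : Family n → Family n
  J F V = F V ∧ not (isEmpty V) ∧
          not (⋃ˡ (filterᵇ (λ A → (A ⊆ᵇ V) ∧ not (A == V)) (members F)) == V)

  Nbd : Family n → Subset n → Subset n
  Nbd F X = X ∪ ⋃ˡ (filterᵇ (λ V → not (isEmpty (V ∩ X))) (members (J F)))

  π : Family n → Subset n → Subset n
  π F X = ⋃ˡ (filterᵇ (λ V → V ⊆ᵇ X) (members F))

  E : Family n → Subset n → Subset n → List (Subset n)
  E F U X = filterᵇ
    (λ Y → (Y ⊆ᵇ U) ∧ ((π F (X ∪ Y) ∩ U) == Y) ∧ ((π F (X ∪ U) ─ U) ⊆ᵇ π F (X ∪ Y)))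
    (allSubsets n)

  -- the quotient a / b as a rational (b = 0 never occurs for extensions; default 0)
  frac : ℕ → ℕ → ℚ
  frac a zero = 0ℚ
  frac a (suc b) = (+ a) / suc b

  μ : Family n → Subset n → Family n → ℚ
  μ F U F' = frac (sum (map (λ X → length (E F U X)) (members (F' ∖ U)))) (card (F' ∖ U))

  _∈F_ : Subset n → Family n → Set
  A ∈F F = F A ≡ true

  UnionClosed : Family n → Set
  UnionClosed F = ∀ A B → F A ≡ true → F B ≡ true → F (A ∪ B) ≡ true

  NonemptyFamily : Family n → Set
  NonemptyFamily F = Data.Product.∃ λ A → F A ≡ true
    where import Data.Product

  Disjoint : Subset n → Subset n → Set
  Disjoint A B = A ∩ B ≡ ⊥

  -- H is an admissible extending family for (F, U): F ∨ H is then an extension of (F, U)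
  ExtFamily : Subset n → Family n → Set
  ExtFamily U H = NonemptyFamily H Data.Product.× UnionClosed H Data.Product.× Disjoint (⋃ H) U
    where import Data.Product

  NonemptyUpSetOf : Subset n → Family n → Set
  NonemptyUpSetOf S H =
    NonemptyFamily H Data.Product.×
    (∀ A → H A ≡ true → A ⊆ S) Data.Product.×
    (∀ A B → H A ≡ true → A ⊆ B → B ⊆ S → H B ≡ true)
    where import Data.Product

  MinimizesμIn : Family n → Subset n → Subset n → Family n → Set
  MinimizesμIn F U D H =
    (⋃ (F ∨ H) ⊆ D) Data.Product.×
    (∀ H'' → ExtFamily U H'' → ⋃ (F ∨ H'') ⊆ D →
       Data.Rational._≤_ (μ F U (F ∨ H)) (μ F U (F ∨ H'')))
    where import Data.Product; import Data.Rational

{-# OPTIONS --safe #-}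
-- With P(X) the largest member of F∖U inside X, a set Y lies in E(X) iff Y ∪ P(X) ∈ F.
-- The families F′∖U of extensions in D are the union-closed G ⊆ 2^(D∖U) closed under
-- adding the sets A∖U, A ∈ F; take one of least average |E|.  Adding A ∪ {z} for all
-- A ∈ G keeps it optimal, and repeating this over z makes it an up-set.  |E(X)| depends only
-- on X ∩ N², so in an optimal up-set the members containing a fixed z ∈ D∖N² are
-- again an optimal up-set; repeating this over z puts D∖N² inside every member.

module Submission where

open import Defs
open import Data.Bool using (Bool; true; false; not; _∧_; if_then_else_)
import Data.Bool as Bool
open import Data.Bool.ListAction using (any)
open import Data.Bool.Properties using (T-≡; ⇔→≡; ∧-conicalˡ; ∧-conicalʳ; ¬-not; not-involutive)
open import Data.Fin using (Fin; zero; suc)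
open import Data.Fin.Subset using (Subset; ⊥; _∪_; _∩_; _─_; _-_; ⁅_⁆; ∣_∣; _⊆_; _∈_; _∉_; inside; outside)
open import Data.Fin.Subset.Properties
import Data.Integer as ℤ
import Data.Integer.Properties as ℤ
open import Data.List using (List; []; _∷_; _++_; map; filterᵇ; length; allFin)
open import Data.List.Membership.Propositional using (find; lose) renaming (_∈_ to _∈ˡ_)
open import Data.List.Membership.Propositional.Properties using
  (∈-allFin; ∈-++⁺ˡ; ∈-++⁺ʳ; ∈-map⁺; ∈-filter⁺; ∈-filter⁻)
open import Data.List.Properties using (map-++; map-∘)
open import Data.List.Relation.Unary.Any using (here; there)
open import Data.List.Relation.Unary.Any.Properties using (any⁺; any⁻)
open import Data.Nat using (ℕ; zero; suc; _+_; _*_; _≤_; _<_; z≤n)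
open import Data.Nat.Induction using (<-wellFounded)
open import Data.Nat.ListAction using (sum)
open import Data.Nat.ListAction.Properties using (sum-++)
open import Data.Nat.Properties using
  (_≤?_; ≤-refl; ≤-trans; <⇒≤; ≰⇒>; n≢0⇒n>0; *-zeroʳ; m≤m+n; m≤n+m; +-comm; +-identityʳ;
   +-commutativeSemigroup; >⇒≢; *-cancelʳ-≤; *-monoˡ-≤; *-assoc; *-comm; +-cancelʳ-≤; *-distribʳ-+;
   *-distribˡ-+; +-monoʳ-≤; module ≤-Reasoning)
open import Algebra.Properties.CommutativeSemigroup +-commutativeSemigroup using (interchange)
open import Data.Product using (Σ; ∃; _×_; _,_; proj₁; proj₂)
import Data.Rational as ℚ
import Data.Rational.Properties as ℚ
import Data.Rational.Unnormalised as ℚᵘ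
import Data.Rational.Unnormalised.Properties as ℚᵘ
open import Data.Sum using (_⊎_; inj₁; inj₂; [_,_]′)
open import Data.Vec using ([]; _∷_; here; there; lookup)
open import Data.Vec.Properties using (≡-dec; lookup⇒[]=; []=⇒lookup)
open import Function using (_∘_)
open import Function.Bundles using (Equivalence; mk⇔)
open import Induction.WellFounded using (Acc; acc)
open import Relation.Binary.PropositionalEquality using
  (_≡_; _≢_; refl; sym; trans; cong; cong₂; subst; subst₂; module ≡-Reasoning)
open import Relation.Nullary using (Dec; yes; no; ¬_; ¬?; contradiction; _→-dec_; _×-dec_)
open import Relation.Nullary.Decidable using (⌊_⌋; toWitness; fromWitness; T?; map′; decidable-stable)

open Equivalence using (to; from)

-- Passing from `H` to the family off `U` loses nothing: μ depends on the extension only through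
-- that family, and an optimal absorbing `G` can itself be taken as `H`, which also settles (ii).
-- The obstacle is that optimality bounds only absorbing families, while the parts of `G` that the
-- argument must weigh need not be absorbing. Both improvements therefore cut `G` in two and bound
-- the opposite part from below. When points are added, that part is absorbing. When a point is
-- forced into every member, it has an absorbing copy of the same mass and size. If one part
-- averages at least the whole, the other averages at most the whole. Averages are compared by
-- cross-multiplying natural numbers, so empty parts need no separate treatment; rationals enter
-- only when the result is turned back into a statement about μ.

private variable
  n : ℕ
  p q r : Subset n
  x : Fin n

-- Boolean tests, subsets and membership in derived families

⌊⌋⁺ : ∀ {P : Set} (P? : Dec P) → P → ⌊ P? ⌋ ≡ true
⌊⌋⁺ P? = to T-≡ ∘ fromWitness {a? = P?}

⌊⌋⁻ : ∀ {P : Set} (P? : Dec P) → ⌊ P? ⌋ ≡ true → P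
⌊⌋⁻ P? = toWitness {a? = P?} ∘ from T-≡

==⁺ : p ≡ q → (p == q) ≡ true
==⁺ = ⌊⌋⁺ (≡-dec Bool._≟_ _ _)

==⁻ : (p == q) ≡ true → p ≡ q
==⁻ = ⌊⌋⁻ (≡-dec Bool._≟_ _ _)

⊆ᵇ⁺ : p ⊆ q → (p ⊆ᵇ q) ≡ true
⊆ᵇ⁺ {p = p} {q} p⊆q = ⌊⌋⁺ (p ⊆? q) p⊆q

⊆ᵇ⁻ : (p ⊆ᵇ q) ≡ true → p ⊆ q
⊆ᵇ⁻ {p = p} {q} eq = ⌊⌋⁻ (p ⊆? q) eq

not⁺ : ∀ {b} → b ≢ true → not b ≡ true
not⁺ {false} _ = refl
not⁺ {true} b≢ = contradiction refl b≢

not⁻ : ∀ {b} → not b ≡ true → b ≢ true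
not⁻ {false} _ ()

∧⁺ : ∀ {a b} → a ≡ true → b ≡ true → a ∧ b ≡ true
∧⁺ refl refl = refl

∧⁻ : ∀ {a b} → a ∧ b ≡ true → a ≡ true × b ≡ true
∧⁻ {a} {b} eq = ∧-conicalˡ a b eq , ∧-conicalʳ a b eq

∨⁺ : ∀ {a b} → a ≡ true ⊎ b ≡ true → a Bool.∨ b ≡ true
∨⁺ {true} _ = refl
∨⁺ {false} (inj₂ eq) = eq

∨⁻ : ∀ {a b} → a Bool.∨ b ≡ true → a ≡ true ⊎ b ≡ true
∨⁻ {true} _ = inj₁ refl
∨⁻ {false} eq = inj₂ eq

∈─⁻ : ∀ (p q : Subset n) → x ∈ p ─ q → x ∈ p × x ∉ q
∈─⁻ p q x∈ = p─q⊆p p q x∈ , ∉q p q x∈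
  where
  ∉q : ∀ {n} {x : Fin n} (p q : Subset n) → x ∈ p ─ q → x ∉ q
  ∉q (_ ∷ p) (inside ∷ q) (there x∈) (there x∈q) = ∉q p q x∈ x∈q
  ∉q (_ ∷ p) (outside ∷ q) (there x∈) (there x∈q) = ∉q p q x∈ x∈q

∈─⁺ : x ∈ p → x ∉ q → x ∈ p ─ q
∈─⁺ = x∈p∧x∉q⇒x∈p─q

∪-least : p ⊆ r → q ⊆ r → p ∪ q ⊆ r
∪-least {p = p} {q = q} p⊆r q⊆r x∈ = [ p⊆r , q⊆r ]′ (x∈p∪q⁻ p q x∈)

∈∪ˡ : x ∈ p → x ∈ p ∪ q
∈∪ˡ = x∈p∪q⁺ ∘ inj₁

∈∪ʳ : x ∈ q → x ∈ p ∪ q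
∈∪ʳ = x∈p∪q⁺ ∘ inj₂

⁅⁆⊆ : x ∈ p → ⁅ x ⁆ ⊆ p
⁅⁆⊆ {x = x} x∈p y∈ = subst (_∈ _) (sym (x∈⁅y⁆⇒x≡y x y∈)) x∈p

≡⊥ : (∀ {x} → x ∉ p) → p ≡ ⊥
≡⊥ ∉p = Empty-unique λ (_ , x∈p) → ∉p x∈p

∈-allSubsets : (p : Subset n) → p ∈ˡ allSubsets n
∈-allSubsets [] = here refl
∈-allSubsets (true ∷ p) = ∈-++⁺ˡ (∈-map⁺ (true ∷_) (∈-allSubsets p))
∈-allSubsets (false ∷ p) = ∈-++⁺ʳ _ (∈-map⁺ (false ∷_) (∈-allSubsets p))

∈-filterᵇ⁺ : ∀ {A : Set} (f : A → Bool) {a as} → a ∈ˡ as → f a ≡ true → a ∈ˡ filterᵇ f as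
∈-filterᵇ⁺ f a∈ fa = ∈-filter⁺ (T? ∘ f) a∈ (from T-≡ fa)

∈-filterᵇ⁻ : ∀ {A : Set} (f : A → Bool) {a as} → a ∈ˡ filterᵇ f as → a ∈ˡ as × f a ≡ true
∈-filterᵇ⁻ f a∈ = let a∈as , fa = ∈-filter⁻ (T? ∘ f) a∈ in a∈as , to T-≡ fa

filterᵇ-cong : ∀ {A : Set} {f g : A → Bool} → (∀ a → f a ≡ g a) → ∀ as → filterᵇ f as ≡ filterᵇ g as
filterᵇ-cong f≗g [] = refl
filterᵇ-cong {f = f} {g} f≗g (a ∷ as) with f a | g a | f≗g a
... | true | true | refl = cong (a ∷_) (filterᵇ-cong f≗g as)
... | false | false | refl = filterᵇ-cong f≗g as

∈-members⁺ : ∀ (F : Family n) → p ∈F F → p ∈ˡ members F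
∈-members⁺ F = ∈-filterᵇ⁺ F (∈-allSubsets _)

∈-members⁻ : ∀ (F : Family n) → p ∈ˡ members F → p ∈F F
∈-members⁻ F = proj₂ ∘ ∈-filterᵇ⁻ F {as = allSubsets _}

any-members⁺ : ∀ (F : Family n) f → p ∈F F → f p ≡ true → any f (members F) ≡ true
any-members⁺ F f p∈F fp = to T-≡ (any⁺ f (lose (∈-members⁺ F p∈F) (from T-≡ fp)))

any-members⁻ : ∀ (F : Family n) f → any f (members F) ≡ true → ∃ λ p → p ∈F F × f p ≡ true
any-members⁻ F f eq =
  let p , p∈ , fp = find (any⁻ f (members F) (from T-≡ eq))
  in p , ∈-members⁻ F p∈ , to T-≡ fp

∈-∨⁺ : ∀ (F H : Family n) → p ∈F F → q ∈F H → (p ∪ q) ∈F (F ∨ H)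
∈-∨⁺ F H p∈F q∈H = any-members⁺ F _ p∈F (any-members⁺ H _ q∈H (==⁺ refl))

∈-∨⁻ : ∀ (F H : Family n) → r ∈F (F ∨ H) → ∃ λ p → ∃ λ q → p ∈F F × q ∈F H × p ∪ q ≡ r
∈-∨⁻ F H r∈ with any-members⁻ F _ r∈
... | p , p∈F , eq with any-members⁻ H _ eq
... | q , q∈H , eq′ = p , q , p∈F , q∈H , ==⁻ eq′

∈-∖⁺ : ∀ (F : Family n) Z → p ∈F F → (p ─ Z) ∈F (F ∖ Z)
∈-∖⁺ F Z p∈F = any-members⁺ F _ p∈F (==⁺ refl)

∈-∖⁻ : ∀ (F : Family n) Z → r ∈F (F ∖ Z) → ∃ λ p → p ∈F F × p ─ Z ≡ r
∈-∖⁻ F Z r∈ = let p , p∈F , eq = any-members⁻ F _ r∈ in p , p∈F , ==⁻ eq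

∈-⋃ˡ⁺ : ∀ {ps} → p ∈ˡ ps → p ⊆ ⋃ˡ ps
∈-⋃ˡ⁺ (here refl) = ∈∪ˡ
∈-⋃ˡ⁺ (there p∈) = ∈∪ʳ ∘ ∈-⋃ˡ⁺ p∈

∈-⋃ˡ⁻ : ∀ (ps : List (Subset n)) → x ∈ ⋃ˡ ps → ∃ λ p → p ∈ˡ ps × x ∈ p
∈-⋃ˡ⁻ [] x∈ = contradiction x∈ ∉⊥
∈-⋃ˡ⁻ (p ∷ ps) x∈ with x∈p∪q⁻ p (⋃ˡ ps) x∈
... | inj₁ x∈p = p , here refl , x∈p
... | inj₂ x∈ps = let q , q∈ , x∈q = ∈-⋃ˡ⁻ ps x∈ps in q , there q∈ , x∈q

⋃ᶠ : Family n → (Subset n → Bool) → Subset n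
⋃ᶠ F f = ⋃ˡ (filterᵇ f (members F))

∈-⋃ᶠ⁺ : ∀ (F : Family n) f → p ∈F F → f p ≡ true → p ⊆ ⋃ᶠ F f
∈-⋃ᶠ⁺ F f p∈F fp = ∈-⋃ˡ⁺ (∈-filterᵇ⁺ f (∈-members⁺ F p∈F) fp)

∈-⋃ᶠ⁻ : ∀ (F : Family n) f → x ∈ ⋃ᶠ F f → ∃ λ p → p ∈F F × f p ≡ true × x ∈ p
∈-⋃ᶠ⁻ F f x∈ =
  let p , p∈ , x∈p = ∈-⋃ˡ⁻ _ x∈
      p∈F , fp = ∈-filterᵇ⁻ f {as = members F} p∈
  in p , ∈-members⁻ F p∈F , fp , x∈p

∈-⋃⁺ : ∀ (F : Family n) → p ∈F F → p ⊆ ⋃ F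
∈-⋃⁺ F p∈F = ∈-⋃ˡ⁺ (∈-members⁺ F p∈F)

∈-⋃⁻ : ∀ (F : Family n) → x ∈ ⋃ F → ∃ λ p → p ∈F F × x ∈ p
∈-⋃⁻ F x∈ = let p , p∈ , x∈p = ∈-⋃ˡ⁻ _ x∈ in p , ∈-members⁻ F p∈ , x∈p

∈-π⁺ : ∀ (F : Family n) X → p ∈F F → p ⊆ X → p ⊆ π F X
∈-π⁺ F X p∈F p⊆X = ∈-⋃ᶠ⁺ F _ p∈F (⊆ᵇ⁺ p⊆X)

∈-π⁻ : ∀ (F : Family n) X → x ∈ π F X → ∃ λ p → p ∈F F × p ⊆ X × x ∈ p
∈-π⁻ F X x∈ = let p , p∈F , eq , x∈p = ∈-⋃ᶠ⁻ F _ x∈ in p , p∈F , ⊆ᵇ⁻ eq , x∈p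

π⊆ : ∀ (F : Family n) X → π F X ⊆ X
π⊆ F X x∈ = let _ , _ , p⊆X , x∈p = ∈-π⁻ F X x∈ in p⊆X x∈p

π-mono : ∀ (F : Family n) {X Y} → X ⊆ Y → π F X ⊆ π F Y
π-mono F {X} {Y} X⊆Y x∈ =
  let p , p∈F , p⊆X , x∈p = ∈-π⁻ F X x∈ in ∈-π⁺ F Y p∈F (⊆-trans p⊆X X⊆Y) x∈p

⋃ˡ∈ : ∀ (F : Family n) → UnionClosed F → ⊥ ∈F F → ∀ ps → (∀ {p} → p ∈ˡ ps → p ∈F F) → ⋃ˡ ps ∈F F
⋃ˡ∈ F uc ⊥∈ [] _ = ⊥∈
⋃ˡ∈ F uc ⊥∈ (p ∷ ps) ps⊆F = uc p _ (ps⊆F (here refl)) (⋃ˡ∈ F uc ⊥∈ ps (ps⊆F ∘ there))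

⋃ᶠ∈ : ∀ (F : Family n) → UnionClosed F → ⊥ ∈F F → ∀ f → ⋃ᶠ F f ∈F F
⋃ᶠ∈ F uc ⊥∈ f = ⋃ˡ∈ F uc ⊥∈ _ λ p∈ → ∈-members⁻ F (proj₁ (∈-filterᵇ⁻ f p∈))

-- Union generators and neighbourhoods

J⊆ : ∀ (F : Family n) → p ∈F J F → p ∈F F
J⊆ F p∈J = proj₁ (∧⁻ p∈J)

properᵇ : Subset n → Subset n → Bool
properᵇ p A = (A ⊆ᵇ p) ∧ not (A == p)

J-or-⋃ : ∀ (F : Family n) → p ∈F F → x ∈ p → p ∈F J F ⊎ ⋃ᶠ F (properᵇ p) ≡ p
J-or-⋃ {p = p} {x = x} F p∈F x∈p with ⋃ᶠ F (properᵇ p) == p in eq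
... | true = inj₂ (==⁻ eq)
... | false = inj₁ (∧⁺ p∈F (∧⁺ (not⁺ λ p≡⊥ → ∉⊥ (subst (x ∈_) (==⁻ {p = p} p≡⊥) x∈p)) refl))

-- A nonempty member that is not a generator is the union of the members properly inside it, so the
-- point lies in a smaller member; descent on cardinality ends at a generator.
generator-∋ : ∀ (F : Family n) → p ∈F F → x ∈ p → ∃ λ V → V ∈F J F × V ⊆ p × x ∈ V
generator-∋ {p = p} F = go p (<-wellFounded ∣ p ∣)
  where
  go : ∀ p → Acc _<_ ∣ p ∣ → p ∈F F → x ∈ p → ∃ λ V → V ∈F J F × V ⊆ p × x ∈ V
  go {x = x} p (acc rec) p∈F x∈p with J-or-⋃ F p∈F x∈p
  ... | inj₁ p∈J = p , p∈J , ⊆-refl , x∈p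
  ... | inj₂ ⋃≡p =
    let q , q∈F , eq , x∈q = ∈-⋃ᶠ⁻ F _ (subst (x ∈_) (sym ⋃≡p) x∈p)
        q⊆ᵇp , q≢ᵇp = ∧⁻ eq
        q⊆p = ⊆ᵇ⁻ q⊆ᵇp
        q≢p = not⁻ q≢ᵇp ∘ ==⁺
        V , V∈J , V⊆q , x∈V = go q (rec (q<p q⊆p q≢p)) q∈F x∈q
    in V , V∈J , ⊆-trans V⊆q q⊆p , x∈V
    where
    q<p : ∀ {q} → q ⊆ p → q ≢ p → ∣ q ∣ < ∣ p ∣
    q<p {q} q⊆p q≢p with nonempty? (p ─ q)
    ... | yes (x , x∈p─q) = p⊂q⇒∣p∣<∣q∣ (q⊆p , x , ∈─⁻ p q x∈p─q)
    ... | no p─q-empty = contradiction (⊆-antisym q⊆p p⊆q) q≢p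
      where
      p⊆q : p ⊆ q
      p⊆q {x} x∈p with x ∈? q
      ... | yes x∈q = x∈q
      ... | no x∉q = contradiction (x , ∈─⁺ x∈p x∉q) p─q-empty

⊆-Nbd : ∀ (F : Family n) X → X ⊆ Nbd F X
⊆-Nbd F X = ∈∪ˡ

generator⊆Nbd : ∀ (F : Family n) X {V} → V ∈F J F → x ∈ V → x ∈ X → V ⊆ Nbd F X
generator⊆Nbd {x = x} F X V∈J x∈V x∈X =
  ∈∪ʳ ∘ ∈-⋃ᶠ⁺ (J F) _ V∈J (not⁺ λ eq → ∉⊥ (subst (x ∈_) (==⁻ eq) (x∈p∩q⁺ (x∈V , x∈X))))

-- The sets E(X) and their dependence on the trace of X

Avoids : Subset n → Subset n → Set
Avoids U X = ∀ {x} → x ∈ X → x ∉ U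

module _ (F : Family n) (U : Subset n) (uc : UnionClosed F) (⊥∈F : ⊥ ∈F F) where

  -- The `P(X)` of the overview: a member `A` of `F` has `A ─ U ⊆ X` exactly when `A ⊆ X ∪ U`, and
  -- `π` collects all such `A`.
  trace : Subset n → Subset n
  trace X = π F (X ∪ U) ─ U

  private
    π∈F : ∀ X → π F X ∈F F
    π∈F X = ⋃ᶠ∈ F uc ⊥∈F (_⊆ᵇ X)

    trace⊆ : ∀ X → trace X ⊆ X
    trace⊆ X x∈ with ∈─⁻ (π F (X ∪ U)) U x∈
    ... | x∈π , x∉U with x∈p∪q⁻ X U (π⊆ F (X ∪ U) x∈π)
    ... | inj₁ x∈X = x∈X
    ... | inj₂ x∈U = contradiction x∈U x∉U

    trace-avoids : ∀ X → Avoids U (trace X)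
    trace-avoids X = proj₂ ∘ ∈─⁻ (π F (X ∪ U)) U

    ∈-trace : ∀ X {A} → A ∈F F → A ⊆ X ∪ U → ∀ {x} → x ∈ A → x ∉ U → x ∈ trace X
    ∈-trace X A∈F A⊆ x∈A = ∈─⁺ (∈-π⁺ F (X ∪ U) A∈F A⊆ x∈A)

    trace-mono : ∀ {X Y} → X ⊆ Y → trace X ⊆ trace Y
    trace-mono {X} {Y} X⊆Y x∈ =
      let x∈π , x∉U = ∈─⁻ (π F (X ∪ U)) U x∈
      in ∈─⁺ (π-mono F (∪-least (∈∪ˡ ∘ X⊆Y) ∈∪ʳ) x∈π) x∉U

  -- Definitionally the test that `E` filters by, so `E` can be compared at two arguments test by
  -- test.
  inE : Subset n → Subset n → Bool
  inE X Y = (Y ⊆ᵇ U) ∧ ((π F (X ∪ Y) ∩ U) == Y) ∧ (trace X ⊆ᵇ π F (X ∪ Y))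

  -- The conditions determine `π F (X ∪ Y)` completely, as `Y` inside `U` and `trace X` outside it,
  -- and `π` takes values in `F`.
  inE⇒ : ∀ {X Y} → Avoids U X → inE X Y ≡ true → Y ⊆ U × (Y ∪ trace X) ∈F F
  inE⇒ {X} {Y} av eq = Y⊆U , subst (_∈F F) (⊆-antisym fwd bwd) (π∈F (X ∪ Y))
    where
    Y⊆U : Y ⊆ U
    Y⊆U = ⊆ᵇ⁻ (proj₁ (∧⁻ eq))
    π∩U≡Y : π F (X ∪ Y) ∩ U ≡ Y
    π∩U≡Y = ==⁻ (proj₁ (∧⁻ (proj₂ (∧⁻ {Y ⊆ᵇ U} eq))))
    fwd : π F (X ∪ Y) ⊆ Y ∪ trace X
    fwd {x} x∈ with x ∈? U
    ... | yes x∈U = ∈∪ˡ (subst (x ∈_) π∩U≡Y (x∈p∩q⁺ (x∈ , x∈U)))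
    ... | no x∉U = ∈∪ʳ (∈─⁺ (π-mono F (∪-least ∈∪ˡ (∈∪ʳ ∘ Y⊆U)) x∈) x∉U)
    bwd : Y ∪ trace X ⊆ π F (X ∪ Y)
    bwd = ∪-least
      (λ x∈Y → p∩q⊆p (π F (X ∪ Y)) U (subst (_ ∈_) (sym π∩U≡Y) x∈Y))
      (⊆ᵇ⁻ (proj₂ (∧⁻ {(π F (X ∪ Y) ∩ U) == Y} (proj₂ (∧⁻ {Y ⊆ᵇ U} eq)))))

  inE⇐ : ∀ {X Y} → Avoids U X → Y ⊆ U → (Y ∪ trace X) ∈F F → inE X Y ≡ true
  inE⇐ {X} {Y} av Y⊆U A∈F = ∧⁺ (⊆ᵇ⁺ Y⊆U) (∧⁺ (==⁺ (⊆-antisym fwd bwd)) (⊆ᵇ⁺ (A⊆π ∘ ∈∪ʳ)))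
    where
    A⊆π : Y ∪ trace X ⊆ π F (X ∪ Y)
    A⊆π = ∈-π⁺ F (X ∪ Y) A∈F (∪-least ∈∪ʳ (∈∪ˡ ∘ trace⊆ X))
    fwd : π F (X ∪ Y) ∩ U ⊆ Y
    fwd x∈ with x∈p∩q⁻ (π F (X ∪ Y)) U x∈
    ... | x∈π , x∈U with x∈p∪q⁻ X Y (π⊆ F (X ∪ Y) x∈π)
    ... | inj₁ x∈X = contradiction x∈U (av x∈X)
    ... | inj₂ x∈Y = x∈Y
    bwd : Y ⊆ π F (X ∪ Y) ∩ U
    bwd x∈Y = x∈p∩q⁺ (A⊆π (∈∪ˡ x∈Y) , Y⊆U x∈Y)

  e : Subset n → ℕ
  e X = length (E F U X)

  e-cong : ∀ {X X′} → Avoids U X → Avoids U X′ →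
           (∀ {Y} → Y ⊆ U → (Y ∪ trace X) ∈F F → (Y ∪ trace X′) ∈F F) →
           (∀ {Y} → Y ⊆ U → (Y ∪ trace X′) ∈F F → (Y ∪ trace X) ∈F F) →
           e X ≡ e X′
  e-cong {X} {X′} av av′ to′ from′ = cong length (filterᵇ-cong same (allSubsets _))
    where
    same : ∀ Y → inE X Y ≡ inE X′ Y
    same Y = ⇔→≡ (mk⇔
      (λ eq → let Y⊆U , A∈F = inE⇒ {Y = Y} av eq in inE⇐ {Y = Y} av′ Y⊆U (to′ Y⊆U A∈F))
      (λ eq → let Y⊆U , A∈F = inE⇒ {Y = Y} av′ eq in inE⇐ {Y = Y} av Y⊆U (from′ Y⊆U A∈F)))

  e-cong-trace : ∀ {X X′} → Avoids U X → Avoids U X′ → trace X ≡ trace X′ → e X ≡ e X′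
  e-cong-trace {X} {X′} av av′ eq = e-cong {X} {X′} av av′
    (λ {Y} _ → subst (λ T → (Y ∪ T) ∈F F) eq) (λ {Y} _ → subst (λ T → (Y ∪ T) ∈F F) (sym eq))

  -- A generator containing z misses N, so it meets neither U nor a generator meeting U.
  e-beyond-N² : ∀ {X z} → Avoids U X → z ∉ Nbd F (Nbd F U) → e (X ∪ ⁅ z ⁆) ≡ e X
  e-beyond-N² {X} {z} av z∉N² = e-cong {X ∪ ⁅ z ⁆} {X} av′ av shrink grow
    where
    N = Nbd F U
    X′ = X ∪ ⁅ z ⁆

    av′ : Avoids U X′
    av′ x∈ with x∈p∪q⁻ X ⁅ z ⁆ x∈
    ... | inj₁ x∈X = av x∈X
    ... | inj₂ x∈z with refl ← x∈⁅y⁆⇒x≡y z x∈z = z∉N² ∘ ⊆-Nbd F N ∘ ⊆-Nbd F U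

    generator-∌z : ∀ {V x} → V ∈F J F → x ∈ V → x ∈ N → z ∉ V
    generator-∌z V∈J x∈V x∈N z∈V = z∉N² (generator⊆Nbd F N V∈J x∈V x∈N z∈V)

    drop-z : ∀ {V} → z ∉ V → V ⊆ X′ ∪ U → V ⊆ X ∪ U
    drop-z z∉V V⊆ x∈V with x∈p∪q⁻ X′ U (V⊆ x∈V)
    ... | inj₂ x∈U = ∈∪ʳ x∈U
    ... | inj₁ x∈X′ with x∈p∪q⁻ X ⁅ z ⁆ x∈X′
    ... | inj₁ x∈X = ∈∪ˡ x∈X
    ... | inj₂ x∈z with refl ← x∈⁅y⁆⇒x≡y z x∈z = contradiction x∈V z∉V

    cover : ∀ A → (∀ {x} → x ∈ A → ∃ λ V → V ∈F F × V ⊆ A × x ∈ V) → A ∈F F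
    cover A cov = subst (_∈F F) (⊆-antisym (π⊆ F A) A⊆π) (π∈F A)
      where
      A⊆π : A ⊆ π F A
      A⊆π x∈A = let V , V∈F , V⊆A , x∈V = cov x∈A in ∈-π⁺ F A V∈F V⊆A x∈V

    Y∪trace⊆ : ∀ {Y Z} → Y ⊆ U → Y ∪ trace Z ⊆ Z ∪ U
    Y∪trace⊆ {Z = Z} Y⊆U = ∪-least (∈∪ʳ ∘ Y⊆U) (∈∪ˡ ∘ trace⊆ Z)

    from-generator : ∀ {Y Z V x} → Y ⊆ U → (∀ {y} → y ∈ V → y ∈ U → y ∈ Y) → V ∈F J F → V ⊆ Z ∪ U → x ∈ V →
                     ∃ λ V → V ∈F F × V ⊆ Y ∪ trace Z × x ∈ V
    from-generator {Y} {Z} {V} Y⊆U V∩U⊆Y V∈J V⊆ x∈V = V , J⊆ F V∈J , V⊆A , x∈V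
      where
      V⊆A : V ⊆ Y ∪ trace Z
      V⊆A {y} y∈V with y ∈? U
      ... | yes y∈U = ∈∪ˡ (V∩U⊆Y y∈V y∈U)
      ... | no y∉U = ∈∪ʳ (∈-trace Z (J⊆ F V∈J) V⊆ y∈V y∉U)

    -- Off N, an element of a trace is covered by a generator that misses U.
    off-N : ∀ {Y Z x} → Y ⊆ U → x ∉ N → x ∈ trace Z → ∃ λ V → V ∈F F × V ⊆ Y ∪ trace Z × x ∈ V
    off-N {Y} {Z} Y⊆U x∉N x∈ =
      let A , A∈F , A⊆ , x∈A = ∈-π⁻ F (Z ∪ U) (proj₁ (∈─⁻ _ U x∈))
          V , V∈J , V⊆A , x∈V = generator-∋ F A∈F x∈A
      in from-generator Y⊆U (λ y∈V y∈U → contradiction (generator⊆Nbd F U V∈J y∈V y∈U x∈V) x∉N)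
           V∈J (⊆-trans V⊆A A⊆) x∈V

    -- At a point of `N`, a generator inside `Y ∪ trace X′` avoids `z`, so it lies in `X ∪ U` and
    -- hence in `Y ∪ trace X`. A point off `N` falls under `off-N`.
    shrink : ∀ {Y} → Y ⊆ U → (Y ∪ trace X′) ∈F F → (Y ∪ trace X) ∈F F
    shrink {Y} Y⊆U A∈F = cover _ cov
      where
      cov : ∀ {x} → x ∈ Y ∪ trace X → ∃ λ V → V ∈F F × V ⊆ Y ∪ trace X × x ∈ V
      cov {x} x∈ with x ∈? N
      ... | yes x∈N =
        let V , V∈J , V⊆A , x∈V = generator-∋ F A∈F (∪-least {p = Y} ∈∪ˡ (∈∪ʳ ∘ trace-mono ∈∪ˡ) x∈)
        in from-generator Y⊆U (λ y∈V y∈U →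
               [ (λ y∈Y → y∈Y) , (λ y∈t → contradiction y∈U (trace-avoids X′ y∈t)) ]′ (x∈p∪q⁻ Y _ (V⊆A y∈V)))
             V∈J (drop-z (generator-∌z V∈J x∈V x∈N) (⊆-trans V⊆A (Y∪trace⊆ Y⊆U))) x∈V
      ... | no x∉N with x∈p∪q⁻ Y (trace X) x∈
      ... | inj₁ x∈Y = contradiction (⊆-Nbd F U (Y⊆U x∈Y)) x∉N
      ... | inj₂ x∈t = off-N Y⊆U x∉N x∈t

    -- The old set `Y ∪ trace X` already covers `Y` and all points of the new trace in `N`: a
    -- generator through such a point avoids `z`, which puts the point in `trace X`. Only points off
    -- `N` need further generators.
    grow : ∀ {Y} → Y ⊆ U → (Y ∪ trace X) ∈F F → (Y ∪ trace X′) ∈F F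
    grow {Y} Y⊆U A∈F = cover _ cov
      where
      A⊆A′ : Y ∪ trace X ⊆ Y ∪ trace X′
      A⊆A′ = ∪-least {p = Y} ∈∪ˡ (∈∪ʳ ∘ trace-mono ∈∪ˡ)
      cov : ∀ {x} → x ∈ Y ∪ trace X′ → ∃ λ V → V ∈F F × V ⊆ Y ∪ trace X′ × x ∈ V
      cov {x} x∈ with x∈p∪q⁻ Y (trace X′) x∈
      ... | inj₁ x∈Y = Y ∪ trace X , A∈F , A⊆A′ , ∈∪ˡ x∈Y
      ... | inj₂ x∈t with x ∈? N
      ... | no x∉N = off-N Y⊆U x∉N x∈t
      ... | yes x∈N =
        let B , B∈F , B⊆ , x∈B = ∈-π⁻ F (X′ ∪ U) (proj₁ (∈─⁻ _ U x∈t))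
            V , V∈J , V⊆B , x∈V = generator-∋ F B∈F x∈B
            V⊆ = drop-z (generator-∌z V∈J x∈V x∈N) (⊆-trans V⊆B B⊆)
        in Y ∪ trace X , A∈F , A⊆A′ , ∈∪ʳ (∈-trace X (J⊆ F V∈J) V⊆ x∈V (trace-avoids X′ x∈t))

-- Weighted counts of families

-- Recursion on the coordinates, rather than a sum over the list `allSubsets`, lets `total-pair`
-- proceed by induction on the position of `z`.
total : (Subset n → ℕ) → ℕ
total {zero} w = w []
total {suc n} w = total (w ∘ (true ∷_)) + total (w ∘ (false ∷_))

total-cong : ∀ {v w : Subset n → ℕ} → (∀ X → v X ≡ w X) → total v ≡ total w
total-cong {zero} v≗w = v≗w []
total-cong {suc n} v≗w = cong₂ _+_ (total-cong (v≗w ∘ (true ∷_))) (total-cong (v≗w ∘ (false ∷_)))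

total-+ : ∀ (v w : Subset n → ℕ) → total (λ X → v X + w X) ≡ total v + total w
total-+ {zero} v w = refl
total-+ {suc n} v w = trans
  (cong₂ _+_ (total-+ (v ∘ (true ∷_)) (w ∘ (true ∷_))) (total-+ (v ∘ (false ∷_)) (w ∘ (false ∷_))))
  (interchange (total (v ∘ (true ∷_))) (total (w ∘ (true ∷_))) (total (v ∘ (false ∷_))) (total (w ∘ (false ∷_))))

total-0 : total {n} (λ _ → 0) ≡ 0
total-0 {zero} = refl
total-0 {suc n} = cong₂ _+_ (total-0 {n}) (total-0 {n})

≤-total : ∀ (w : Subset n → ℕ) X → w X ≤ total w
≤-total w [] = ≤-refl
≤-total w (true ∷ X) = ≤-trans (≤-total (w ∘ (true ∷_)) X) (m≤m+n _ _)
≤-total w (false ∷ X) = ≤-trans (≤-total (w ∘ (false ∷_)) X) (m≤n+m _ _)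

-- Subsets are paired as `X`, `X ∪ ⁅ z ⁆` with `z ∉ X`, and each pair is charged to its member
-- without `z`.
total-pair : ∀ (w : Subset n → ℕ) z →
             total w ≡ total (λ X → if lookup X z then 0 else w X + w (X ∪ ⁅ z ⁆))
total-pair {suc n} w zero = begin
  total (w ∘ (true ∷_)) + total (w ∘ (false ∷_))
    ≡⟨ +-comm (total (w ∘ (true ∷_))) _ ⟩
  total (w ∘ (false ∷_)) + total (w ∘ (true ∷_))
    ≡⟨ total-+ (w ∘ (false ∷_)) (w ∘ (true ∷_)) ⟨
  total (λ X → w (false ∷ X) + w (true ∷ X))
    ≡⟨ total-cong (λ X → cong (λ Y → w (false ∷ X) + w (true ∷ Y)) (∪-identityʳ X)) ⟨
  total (λ X → w (false ∷ X) + w (true ∷ (X ∪ ⊥)))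
    ≡⟨ cong (_+ total (λ X → w (false ∷ X) + w (true ∷ (X ∪ ⊥)))) (total-0 {n}) ⟨
  total {n} (λ _ → 0) + total (λ X → w (false ∷ X) + w (true ∷ (X ∪ ⊥))) ∎
  where open ≡-Reasoning
total-pair {suc n} w (suc z) =
  cong₂ _+_ (total-pair (w ∘ (true ∷_)) z) (total-pair (w ∘ (false ∷_)) z)

restrict : (Subset n → ℕ) → Family n → Subset n → ℕ
restrict w G X = if G X then w X else 0

mass : (Subset n → ℕ) → Family n → ℕ
mass w G = total (restrict w G)

size : Family n → ℕ
size = mass (λ _ → 1)

sum-allSubsets : ∀ (w : Subset n → ℕ) → sum (map w (allSubsets n)) ≡ total w
sum-allSubsets {zero} w = +-identityʳ _
sum-allSubsets {suc n} w = begin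
  sum (map w (map (true ∷_) A ++ map (false ∷_) A))
    ≡⟨ cong sum (map-++ w (map (true ∷_) A) _) ⟩
  sum (map w (map (true ∷_) A) ++ map w (map (false ∷_) A))
    ≡⟨ sum-++ (map w (map (true ∷_) A)) _ ⟩
  sum (map w (map (true ∷_) A)) + sum (map w (map (false ∷_) A))
    ≡⟨ cong₂ (λ xs ys → sum xs + sum ys) (map-∘ A) (map-∘ A) ⟨
  sum (map (w ∘ (true ∷_)) A) + sum (map (w ∘ (false ∷_)) A)
    ≡⟨ cong₂ _+_ (sum-allSubsets (w ∘ (true ∷_))) (sum-allSubsets (w ∘ (false ∷_))) ⟩
  total w ∎
  where
  open ≡-Reasoning
  A = allSubsets n

sum-members : ∀ (w : Subset n → ℕ) G → sum (map w (members G)) ≡ mass w G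
sum-members w G = trans (sum-filterᵇ (allSubsets _)) (sum-allSubsets (restrict w G))
  where
  sum-filterᵇ : ∀ Xs → sum (map w (filterᵇ G Xs)) ≡ sum (map (restrict w G) Xs)
  sum-filterᵇ [] = refl
  sum-filterᵇ (X ∷ Xs) with G X
  ... | true = cong (w X +_) (sum-filterᵇ Xs)
  ... | false = sum-filterᵇ Xs

card≡size : ∀ (G : Family n) → card G ≡ size G
card≡size G = trans (length-sum (members G)) (sum-members _ G)
  where
  length-sum : ∀ {A : Set} (as : List A) → length as ≡ sum (map (λ _ → 1) as)
  length-sum [] = refl
  length-sum (_ ∷ as) = cong suc (length-sum as)

mass-cong : ∀ {v w : Subset n → ℕ} {G} → (∀ {X} → X ∈F G → v X ≡ w X) → mass v G ≡ mass w G
mass-cong {v = v} {w} {G} v≡w = total-cong pointwise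
  where
  pointwise : ∀ X → restrict v G X ≡ restrict w G X
  pointwise X with G X in eq
  ... | true = v≡w eq
  ... | false = refl

mass-congᶠ : ∀ (w : Subset n → ℕ) {G H} → (∀ X → G X ≡ H X) → mass w G ≡ mass w H
mass-congᶠ w G≗H = total-cong λ X → cong (if_then w X else 0) (G≗H X)

size>0 : ∀ {G : Family n} → NonemptyFamily G → 0 < size G
size>0 {G = G} (A , A∈G) =
  subst (λ b → (if b then 1 else 0) ≤ size G) A∈G (≤-total (restrict (λ _ → 1) G) A)

size>0⁻ : ∀ {G : Family n} → 0 < size G → NonemptyFamily G
size>0⁻ {n} {G} 0<size with anySubset? (λ X → G X Bool.≟ true)
... | yes G-nonempty = G-nonempty
... | no G-empty = contradiction (trans (mass-congᶠ (λ _ → 1) G≗∅) (total-0 {n})) (>⇒≢ 0<size)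
  where
  G≗∅ : ∀ X → G X ≡ false
  G≗∅ X = ¬-not λ X∈G → G-empty (X , X∈G)

mass-partition : ∀ (w : Subset n → ℕ) (G Q : Family n) →
                 mass w G ≡ mass w (λ X → G X ∧ Q X) + mass w (λ X → G X ∧ not (Q X))
mass-partition w G Q = trans (total-cong pointwise) (total-+ (restrict w _) (restrict w _))
  where
  pointwise : ∀ X → restrict w G X ≡ restrict w (λ X → G X ∧ Q X) X + restrict w (λ X → G X ∧ not (Q X)) X
  pointwise X with G X | Q X
  ... | false | _ = refl
  ... | true | true = sym (+-identityʳ _)
  ... | true | false = refl

infixr 5 _∪ᶠ_
_∪ᶠ_ : Family n → Family n → Family n
(G ∪ᶠ H) X = G X Bool.∨ H X

mass-∪ᶠ : ∀ (w : Subset n → ℕ) G H → (∀ {X} → X ∈F H → ¬ (X ∈F G)) → mass w (G ∪ᶠ H) ≡ mass w G + mass w H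
mass-∪ᶠ w G H disjoint = trans (total-cong pointwise) (total-+ (restrict w _) (restrict w _))
  where
  pointwise : ∀ X → restrict w (G ∪ᶠ H) X ≡ restrict w G X + restrict w H X
  pointwise X with G X in X∈G | H X in X∈H
  ... | true | true = contradiction X∈G (disjoint X∈H)
  ... | true | false = sym (+-identityʳ _)
  ... | false | _ = refl

-- Shifting a family onto a point

-- The image under adding `z` of the members of `G` that miss `z`, expressed through the preimage
-- `Y - z`.
shift : Fin n → Family n → Family n
shift z G Y = lookup Y z ∧ G (Y - z)

∪⁅⁆-absorb : x ∈ p → p ∪ ⁅ x ⁆ ≡ p
∪⁅⁆-absorb x∈p = ⊆-antisym (∪-least ⊆-refl (⁅⁆⊆ x∈p)) ∈∪ˡ

-∪⁅⁆ : x ∈ p → (p - x) ∪ ⁅ x ⁆ ≡ p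
-∪⁅⁆ {x = x} {p = p} x∈p = ⊆-antisym (∪-least (p─q⊆p p ⁅ x ⁆) (⁅⁆⊆ x∈p)) sup
  where
  sup : p ⊆ (p - x) ∪ ⁅ x ⁆
  sup {y} y∈p with y ∈? ⁅ x ⁆
  ... | yes y∈x = ∈∪ʳ y∈x
  ... | no y∉x = ∈∪ˡ (∈─⁺ y∈p y∉x)

∪⁅⁆- : x ∉ p → (p ∪ ⁅ x ⁆) - x ≡ p
∪⁅⁆- {x = x} {p = p} x∉p = ⊆-antisym sub sup
  where
  sub : (p ∪ ⁅ x ⁆) - x ⊆ p
  sub y∈ with ∈─⁻ (p ∪ ⁅ x ⁆) ⁅ x ⁆ y∈
  ... | y∈∪ , y∉x with x∈p∪q⁻ p ⁅ x ⁆ y∈∪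
  ... | inj₁ y∈p = y∈p
  ... | inj₂ y∈x = contradiction y∈x y∉x
  sup : p ⊆ (p ∪ ⁅ x ⁆) - x
  sup y∈p = ∈─⁺ (∈∪ˡ y∈p) λ y∈x → x∉p (subst (_∈ p) (x∈⁅y⁆⇒x≡y x y∈x) y∈p)

∈-shift⁻ : ∀ {G : Family n} → p ∈F shift x G → x ∈ p × (p - x) ∈F G
∈-shift⁻ {p = p} {x} p∈ = let l , g = ∧⁻ {lookup p x} p∈ in lookup⇒[]= x p l , g

∈-shift⁺ : ∀ {G : Family n} → x ∈ p → (p - x) ∈F G → p ∈F shift x G
∈-shift⁺ x∈p p-x∈G = ∧⁺ ([]=⇒lookup x∈p) p-x∈G

-- In every pair `X`, `X ∪ ⁅ z ⁆` each side has at most one nonzero term: the shifted family sits on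
-- the upper set and `G` on the lower one.
mass-shift : ∀ (w : Subset n → ℕ) z {G} → (∀ {X} → X ∈F G → z ∉ X) →
             mass w (shift z G) ≡ mass (λ X → w (X ∪ ⁅ z ⁆)) G
mass-shift w z {G} G∌z =
  trans (total-pair _ z) (trans (total-cong pointwise) (sym (total-pair _ z)))
  where
  v = λ X → w (X ∪ ⁅ z ⁆)
  pointwise : ∀ X → (if lookup X z then 0 else restrict w (shift z G) X + restrict w (shift z G) (X ∪ ⁅ z ⁆)) ≡
                    (if lookup X z then 0 else restrict v G X + restrict v G (X ∪ ⁅ z ⁆))
  pointwise X with lookup X z in X∌z
  ... | true = refl
  ... | false
    rewrite ∪⁅⁆- {x = z} {p = X} (λ z∈X → contradiction (trans (sym X∌z) ([]=⇒lookup z∈X)) λ ())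
          | []=⇒lookup (∈∪ʳ {p = X} (x∈⁅x⁆ z))
          | ¬-not {G (X ∪ ⁅ z ⁆)} (λ X∪z∈G → G∌z X∪z∈G (∈∪ʳ (x∈⁅x⁆ z)))
    = sym (+-identityʳ _)

-- Enumeration of families and comparison of averages

-- Families are functions, so they are listed only up to pointwise equality, by choosing which
-- entries of the list belong. This makes the search for a minimum finite.
enumerate : List (Subset n) → List (Family n)
enumerate [] = (λ _ → false) ∷ []
enumerate (X ∷ Xs) = map (λ G Y → (Y == X) Bool.∨ G Y) (enumerate Xs) ++ enumerate Xs

enumerate-complete : ∀ (G : Family n) Xs → ∃ λ H → H ∈ˡ enumerate Xs ×
  (∀ {Y} → Y ∈F H → Y ∈F G) × (∀ {Y} → Y ∈ˡ Xs → Y ∈F G → Y ∈F H)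
enumerate-complete G [] = _ , here refl , (λ ()) , λ ()
enumerate-complete G (X ∷ Xs) with enumerate-complete G Xs | G X in eq
... | H , H∈ , H⊆G , G⊆H | true =
  _ , ∈-++⁺ˡ (∈-map⁺ _ H∈)
  , (λ Y∈ → [ (λ Y==X → subst (_∈F G) (sym (==⁻ Y==X)) eq) , H⊆G ]′ (∨⁻ {_ == X} Y∈))
  , λ { (here Y≡X) _ → ∨⁺ (inj₁ (==⁺ Y≡X)) ; {Y} (there Y∈) Y∈G → ∨⁺ {Y == X} (inj₂ (G⊆H Y∈ Y∈G)) }
... | H , H∈ , H⊆G , G⊆H | false =
  _ , ∈-++⁺ʳ _ H∈ , H⊆G
  , λ { (here refl) Y∈G → contradiction (trans (sym eq) Y∈G) λ () ; (there Y∈) Y∈G → G⊆H Y∈ Y∈G }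

-- Only the middle denominator has to be positive, since it is the one that gets cancelled; the
-- outer two may be 0.
ratio-trans : ∀ {s c s₁ c₁ s₂ c₂} → 0 < c → s₁ * c ≤ s * c₁ → s * c₂ ≤ s₂ * c → s₁ * c₂ ≤ s₂ * c₁
ratio-trans {s} {c@(suc _)} {s₁} {c₁} {s₂} {c₂} _ p q = *-cancelʳ-≤ _ _ c (begin
  s₁ * c₂ * c   ≡⟨ swapʳ s₁ c₂ c ⟩
  s₁ * c * c₂   ≤⟨ *-monoˡ-≤ c₂ p ⟩
  s * c₁ * c₂   ≡⟨ swapʳ s c₁ c₂ ⟩
  s * c₂ * c₁   ≤⟨ *-monoˡ-≤ c₁ q ⟩
  s₂ * c * c₁   ≡⟨ swapʳ s₂ c c₁ ⟩
  s₂ * c₁ * c   ∎)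
  where
  open ≤-Reasoning
  swapʳ : ∀ a b d → a * b * d ≡ a * d * b
  swapʳ a b d = trans (*-assoc a b d) (trans (cong (a *_) (*-comm b d)) (sym (*-assoc a d b)))

-- With masses `a`, `b` and sizes `x`, `y` of two parts, this is the averaging principle behind both
-- improvements of a minimal family.
ratio-complement : ∀ a b x y → (a + b) * y ≤ b * (x + y) → a * (x + y) ≤ (a + b) * x
ratio-complement a b x y p = +-cancelʳ-≤ (b * (x + y)) _ _ (begin
  a * (x + y) + b * (x + y)   ≡⟨ *-distribʳ-+ (x + y) a b ⟨
  (a + b) * (x + y)           ≡⟨ *-distribˡ-+ (a + b) x y ⟩
  (a + b) * x + (a + b) * y   ≤⟨ +-monoʳ-≤ _ p ⟩
  (a + b) * x + b * (x + y)   ∎)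
  where open ≤-Reasoning

-- Since `_/_` reduces to lowest terms, the comparison is made among unnormalised rationals, where
-- the order is cross-multiplication.
frac-mono : ∀ {a b c d} → 0 < b → 0 < d → a * d ≤ c * b → frac {n} a b ℚ.≤ frac {n} c d
frac-mono {_} {a} {suc b} {c} {suc d} _ _ p = ℚ.toℚᵘ-cancel-≤ (begin
  ℚ.toℚᵘ (ℚ.fromℚᵘ (ℚᵘ.mkℚᵘ (ℤ.+ a) b))   ≃⟨ ℚ.toℚᵘ-fromℚᵘ (ℚᵘ.mkℚᵘ (ℤ.+ a) b) ⟩
  ℚᵘ.mkℚᵘ (ℤ.+ a) b                         ≤⟨ ℚᵘ.*≤* (subst₂ ℤ._≤_ (ℤ.pos-* a (suc d)) (ℤ.pos-* c (suc b)) (ℤ.+≤+ p)) ⟩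
  ℚᵘ.mkℚᵘ (ℤ.+ c) d                         ≃⟨ ℚ.toℚᵘ-fromℚᵘ (ℚᵘ.mkℚᵘ (ℤ.+ c) d) ⟨
  ℚ.toℚᵘ (ℚ.fromℚᵘ (ℚᵘ.mkℚᵘ (ℤ.+ c) d))   ∎)
  where open ℚᵘ.≤-Reasoning

-- Absorbing families of least average weight

module Minimizers (F : Family n) (U D : Subset n) (uc : UnionClosed F) (⊥∈F : ⊥ ∈F F) (⋃F⊆D : ⋃ F ⊆ D) where

  N² : Subset n
  N² = Nbd F (Nbd F U)

  weight : Subset n → ℕ
  weight = e F U uc ⊥∈F

  Within : Family n → Set
  Within G = ∀ A → A ∈F G → A ⊆ D ─ U

  Absorbs : Family n → Set
  Absorbs G = ∀ A B → A ∈F F → B ∈F G → ((A ─ U) ∪ B) ∈F G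

  -- These are the families F′∖U of the extensions F′ of (F, U) inside D.
  Absorbing : Family n → Set
  Absorbing G = Within G × UnionClosed G × Absorbs G

  UpClosed : Family n → Set
  UpClosed G = ∀ A B → A ∈F G → A ⊆ B → B ⊆ D ─ U → B ∈F G

  infix 4 _≼_
  -- Compares average weights. It holds trivially if either family is empty: `≼-all` may thus range
  -- over empty families too, and `Minimal` must ask for nonemptiness separately.
  _≼_ : Family n → Family n → Set
  G ≼ H = mass weight G * size H ≤ mass weight H * size G

  record Minimal (G : Family n) : Set where
    field
      nonempty : NonemptyFamily G
      absorbing : Absorbing G
      ≼-all : ∀ H → Absorbing H → G ≼ H

  within-avoids : ∀ {G A} → Within G → A ∈F G → Avoids U A
  within-avoids within A∈G x∈A = proj₂ (∈─⁻ D U (within _ A∈G x∈A))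

  member⊆D : ∀ {A} → A ∈F F → A ⊆ D
  member⊆D A∈F = ⊆-trans (∈-⋃⁺ F A∈F) ⋃F⊆D

  A─U⊆D─U : ∀ {A} → A ∈F F → A ─ U ⊆ D ─ U
  A─U⊆D─U {A} A∈F x∈ = let x∈A , x∉U = ∈─⁻ A U x∈ in ∈─⁺ (member⊆D A∈F x∈A) x∉U

  upClosed⇒absorbing : ∀ {G} → Within G → UpClosed G → Absorbing G
  upClosed⇒absorbing within up = within
    , (λ A B A∈G B∈G → up A _ A∈G ∈∪ˡ (∪-least (within A A∈G) (within B B∈G)))
    , (λ A B A∈F B∈G → up B _ B∈G ∈∪ʳ (∪-least (A─U⊆D─U A∈F) (within B B∈G)))

  minimal-≼ : ∀ {G H} → Minimal G → NonemptyFamily H → Absorbing H → H ≼ G → Minimal H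
  minimal-≼ {G} {H} min ne abs H≼G = record
    { nonempty = ne
    ; absorbing = abs
    ; ≼-all = λ K absK → ratio-trans {mass weight G} {size G} {mass weight H} {size H} {mass weight K} {size K}
        (size>0 (Minimal.nonempty min)) H≼G (Minimal.≼-all min K absK)
    }

  ∀Subset? : ∀ {P : Subset n → Set} → (∀ A → Dec (P A)) → Dec (∀ A → P A)
  ∀Subset? P? = map′ (λ ∄ A → decidable-stable (P? A) (λ ¬P → ∄ (A , ¬P))) (λ ∀P (A , ¬P) → ¬P (∀P A))
    (¬? (anySubset? (¬? ∘ P?)))

  absorbing? : ∀ G → Dec (Absorbing G)
  absorbing? G =
    ∀Subset? (λ A → (G A Bool.≟ true) →-dec (A ⊆? D ─ U))
    ×-dec ∀Subset? (λ A → ∀Subset? λ B → (G A Bool.≟ true) →-dec (G B Bool.≟ true) →-dec (G (A ∪ B) Bool.≟ true))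
    ×-dec ∀Subset? (λ A → ∀Subset? λ B → (F A Bool.≟ true) →-dec (G B Bool.≟ true) →-dec (G ((A ─ U) ∪ B) Bool.≟ true))

  absorbing-cong : ∀ {G H} → (∀ A → G A ≡ H A) → Absorbing G → Absorbing H
  absorbing-cong G≗H (within , join , absorbs) =
      (λ A A∈H → within A (H⇒G A∈H))
    , (λ A B A∈H B∈H → G⇒H (join A B (H⇒G A∈H) (H⇒G B∈H)))
    , (λ A B A∈F B∈H → G⇒H (absorbs A B A∈F (H⇒G B∈H)))
    where
    H⇒G = λ {A} A∈H → trans (G≗H A) A∈H
    G⇒H = λ {A} A∈G → trans (sym (G≗H A)) A∈G

  ≼-minimum : ∀ Gs → ∃ λ G → NonemptyFamily G × Absorbing G × (∀ {H} → H ∈ˡ Gs → Absorbing H → G ≼ H)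
  -- The up-set `{D ─ U}` seeds the search, so that a nonempty candidate is always at hand.
  ≼-minimum [] = (_== D ─ U) , (D ─ U , ==⁺ refl) , upClosed⇒absorbing within up , λ ()
    where
    within : Within (_== D ─ U)
    within A eq = subst (_⊆ D ─ U) (sym (==⁻ {p = A} eq)) ⊆-refl
    up : UpClosed (_== D ─ U)
    up A B eq A⊆B B⊆ = ==⁺ (⊆-antisym B⊆ (subst (_⊆ B) (==⁻ {p = A} eq) A⊆B))
  ≼-minimum (H ∷ Gs) with ≼-minimum Gs
  ... | G , ne , abs , G≼ with absorbing? H | mass weight G * size H ≤? mass weight H * size G
  ... | no ¬absH | _ = G , ne , abs , λ { (here refl) absH → contradiction absH ¬absH ; (there H∈) → G≼ H∈ }
  ... | yes _ | yes G≼H = G , ne , abs , λ { (here refl) _ → G≼H ; (there H∈) → G≼ H∈ }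
  ... | yes absH | no G⋠H = H , size>0⁻ 0<sizeH , absH , λ
    { (here refl) _ → ≤-refl
    ; {K} (there K∈) absK → ratio-trans {mass weight G} {size G} {mass weight H} {size H} {mass weight K} {size K}
        (size>0 ne) (<⇒≤ (≰⇒> G⋠H)) (G≼ K∈ absK)
    }
    where
    0<sizeH : 0 < size H
    -- An empty `H` would satisfy `G ≼ H`, so the new candidate is nonempty.
    0<sizeH = n≢0⇒n>0 λ size≡0 → G⋠H (subst (_≤ mass weight H * size G)
      (sym (trans (cong (mass weight G *_) size≡0) (*-zeroʳ (mass weight G)))) z≤n)

  minimal-exists : ∃ Minimal
  minimal-exists with ≼-minimum (enumerate (allSubsets n))
  ... | G , ne , abs , G≼ = G , record { nonempty = ne ; absorbing = abs ; ≼-all = ≼-all }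
    where
    ≼-all : ∀ H → Absorbing H → G ≼ H
    ≼-all H absH =
      let K , K∈ , K⊆H , H⊆K = enumerate-complete H (allSubsets n)
          K≗H : ∀ A → K A ≡ H A
          K≗H A = ⇔→≡ (mk⇔ K⊆H (H⊆K (∈-allSubsets A)))
      in subst₂ (λ s c → mass weight G * c ≤ s * size G) (mass-congᶠ weight K≗H) (mass-congᶠ (λ _ → 1) K≗H)
           (G≼ K∈ (absorbing-cong (sym ∘ K≗H) absH))

  -- Saturating and pinning a minimal family

  complement-≼ : ∀ {G} Q → G ≼ (λ A → G A ∧ not (Q A)) → (λ A → G A ∧ Q A) ≼ G
  complement-≼ {G} Q G≼GQ̄ =
    subst₂ (λ s c → mass weight GQ * c ≤ s * size GQ) (sym s≡) (sym c≡)
      (ratio-complement (mass weight GQ) (mass weight GQ̄) (size GQ) (size GQ̄)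
        (subst₂ (λ s c → s * size GQ̄ ≤ mass weight GQ̄ * c) s≡ c≡ G≼GQ̄))
    where
    GQ GQ̄ : Family n
    GQ A = G A ∧ Q A
    GQ̄ A = G A ∧ not (Q A)
    s≡ = mass-partition weight G Q
    c≡ = mass-partition (λ _ → 1) G Q

  -- A member A of G with A ∪ {z} new has the same weight as A ∪ {z}, since absorption
  -- leaves no room for a larger trace in A ∪ {z}.  The other members are absorbing, hence
  -- at least minimal on average, so those A are at most minimal on average.
  module Saturate {G : Family n} (min : Minimal G) {z : Fin n} (z∈D─U : z ∈ D ─ U) where
    open Minimal min
    private
      within = proj₁ absorbing
      join = proj₁ (proj₂ absorbing)
      absorbs = proj₂ (proj₂ absorbing)

    _+z : Subset n → Subset n
    A +z = A ∪ ⁅ z ⁆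

    old : Family n
    old A = G (A +z)

    K : Family n
    K A = G A ∧ not (old A)

    -- As a set of sets this is `G` together with `A +z` for all `A` in `G`; shifting only `K` makes
    -- the union disjoint, so that masses add.
    saturated : Family n
    saturated = G ∪ᶠ shift z K

    K-∌z : ∀ {A} → A ∈F K → z ∉ A
    K-∌z {A} A∈K z∈A = let A∈G , new = ∧⁻ {G A} A∈K in
      not⁻ {G (A +z)} new (subst (_∈F G) (sym (∪⁅⁆-absorb z∈A)) A∈G)

    saturated⁺ : ∀ {A} → A ∈F G → (A +z) ∈F saturated
    saturated⁺ {A} A∈G with G (A +z) Bool.≟ true
    ... | yes A+z∈G = ∨⁺ (inj₁ A+z∈G)
    ... | no A+z∉G = ∨⁺ {G (A +z)} (inj₂ (∈-shift⁺ {G = K} (∈∪ʳ (x∈⁅x⁆ z)) (subst (_∈F K) (sym (∪⁅⁆- (K-∌z A∈K))) A∈K)))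
      where
      A∈K : A ∈F K
      A∈K = ∧⁺ {G A} A∈G (not⁺ {G (A +z)} A+z∉G)

    saturated⁻ : ∀ {C} → C ∈F saturated → ∃ λ A → A ∈F G × (C ≡ A ⊎ C ≡ A +z)
    saturated⁻ {C} C∈ with ∨⁻ {G C} C∈
    ... | inj₁ C∈G = C , C∈G , inj₁ refl
    ... | inj₂ C∈shift =
      let z∈C , C-z∈K = ∈-shift⁻ {G = K} C∈shift
      in C - z , proj₁ (∧⁻ {G (C - z)} C-z∈K) , inj₂ (sym (-∪⁅⁆ z∈C))

    G⊆saturated : ∀ {A} → A ∈F G → A ∈F saturated
    G⊆saturated A∈G = ∨⁺ (inj₁ A∈G)

    saturated-closed : ∀ (f : Subset n → Subset n) → (∀ A → f (A +z) ≡ (f A) +z) →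
                       (∀ {A} → A ∈F G → f A ∈F saturated × (f A +z) ∈F saturated) →
                       ∀ {C} → C ∈F saturated → f C ∈F saturated
    saturated-closed f f-+z f-G C∈ with saturated⁻ C∈
    ... | A , A∈G , inj₁ refl = proj₁ (f-G A∈G)
    ... | A , A∈G , inj₂ refl = subst (_∈F saturated) (sym (f-+z A)) (proj₂ (f-G A∈G))

    -- Every member of `saturated` is `A` or `A +z` with `A` in `G`, so closure under an operation
    -- commuting with `_+z` lifts from `G`. It gives absorption, unions with members of `G`, and the
    -- survival of closure under points treated earlier.
    preserves : ∀ (f : Subset n → Subset n) → (∀ A → f (A +z) ≡ (f A) +z) → (∀ {A} → A ∈F G → f A ∈F G) →
                ∀ {C} → C ∈F saturated → f C ∈F saturated
    preserves f f-+z f-G = saturated-closed f f-+z λ A∈G → G⊆saturated (f-G A∈G) , saturated⁺ (f-G A∈G)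

    +z-idem : ∀ A → (A +z) +z ≡ A +z
    +z-idem A = trans (∪-assoc A ⁅ z ⁆ ⁅ z ⁆) (cong (A ∪_) (∪-idem ⁅ z ⁆))

    +z-∪ : ∀ A B → (A +z) ∪ B ≡ (A ∪ B) +z
    +z-∪ A B = trans (∪-assoc A ⁅ z ⁆ B) (trans (cong (A ∪_) (∪-comm ⁅ z ⁆ B)) (sym (∪-assoc A B ⁅ z ⁆)))

    saturated-+z : ∀ {C} → C ∈F saturated → (C +z) ∈F saturated
    saturated-+z = saturated-closed _+z (λ _ → refl)
      λ {A} A∈G → saturated⁺ A∈G , subst (_∈F saturated) (sym (+z-idem A)) (saturated⁺ A∈G)

    saturated-absorbing : Absorbing saturated
    saturated-absorbing = within′ , join′ , λ A B A∈F →
      preserves ((A ─ U) ∪_) (λ B → sym (∪-assoc (A ─ U) B ⁅ z ⁆)) (absorbs A _ A∈F)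
      where
      within′ : Within saturated
      within′ C C∈ with saturated⁻ C∈
      ... | A , A∈G , inj₁ refl = within A A∈G
      ... | A , A∈G , inj₂ refl = ∪-least (within A A∈G) (⁅⁆⊆ z∈D─U)
      join′ : UnionClosed saturated
      join′ A B A∈ B∈ with saturated⁻ B∈
      ... | B′ , B′∈G , inj₁ refl = preserves (_∪ B′) (λ A → +z-∪ A B′) (λ A∈G → join _ B′ A∈G B′∈G) A∈
      ... | B′ , B′∈G , inj₂ refl = subst (_∈F saturated) (∪-assoc A B′ ⁅ z ⁆)
        (saturated-+z (preserves (_∪ B′) (λ A → +z-∪ A B′) (λ A∈G → join _ B′ A∈G B′∈G) A∈))

    -- Unlike `K`, this part inherits both closure properties, because they apply to `A` and to
    -- `A +z` alike. The double negation is the complement of `K` in `G` as `complement-≼` produces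
    -- it.
    old-absorbing : Absorbing (λ A → G A ∧ not (not (old A)))
    old-absorbing =
        (λ A A∈ → within A (proj₁ (split A∈)))
      , (λ A B A∈ B∈ → let A∈G , _ = split A∈ ; B∈G , B+z∈G = split B∈ in
           pair (join A B A∈G B∈G) (subst (_∈F G) (sym (∪-assoc A B ⁅ z ⁆)) (join A _ A∈G B+z∈G)))
      , (λ A B A∈F B∈ → let B∈G , B+z∈G = split B∈ in
           pair (absorbs A B A∈F B∈G) (subst (_∈F G) (sym (∪-assoc (A ─ U) B ⁅ z ⁆)) (absorbs A _ A∈F B+z∈G)))
      where
      split : ∀ {A} → G A ∧ not (not (old A)) ≡ true → A ∈F G × (A +z) ∈F G
      split {A} A∈ = let A∈G , eq = ∧⁻ {G A} A∈ in A∈G , trans (sym (not-involutive _)) eq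
      pair : ∀ {A} → A ∈F G → (A +z) ∈F G → G A ∧ not (not (old A)) ≡ true
      pair {A} A∈G A+z∈G = ∧⁺ {G A} A∈G (trans (not-involutive _) A+z∈G)

    trace-+z : ∀ {A} → A ∈F K → trace F U uc ⊥∈F (A +z) ≡ trace F U uc ⊥∈F A
    trace-+z {A} A∈K = cong (_─ U) (⊆-antisym π⊆ₐ (π-mono F (∪-least (∈∪ˡ ∘ ∈∪ˡ) ∈∪ʳ)))
      where
      A∈G = proj₁ (∧⁻ {G A} A∈K)
      A+z∉G = not⁻ {G (A +z)} (proj₂ (∧⁻ {G A} A∈K))
      B = π F ((A +z) ∪ U)
      B∈F : B ∈F F
      B∈F = ⋃ᶠ∈ F uc ⊥∈F (_⊆ᵇ (A +z) ∪ U)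
      -- If `z` were in `B`, absorbing `B` into `A` would give exactly `A +z`, which is not in `G`.
      z∉B : z ∉ B
      z∉B z∈B = A+z∉G (subst (_∈F G) (⊆-antisym fwd bwd) (absorbs B A B∈F A∈G))
        where
        fwd : (B ─ U) ∪ A ⊆ A +z
        fwd = ∪-least (λ x∈ → let x∈B , x∉U = ∈─⁻ B U x∈ in
          [ (λ x∈A+z → x∈A+z) , (λ x∈U → contradiction x∈U x∉U) ]′ (x∈p∪q⁻ (A +z) U (π⊆ F _ x∈B))) ∈∪ˡ
        bwd : A +z ⊆ (B ─ U) ∪ A
        bwd = ∪-least ∈∪ʳ (⁅⁆⊆ (∈∪ˡ (∈─⁺ z∈B (proj₂ (∈─⁻ D U z∈D─U)))))
      B⊆A∪U : B ⊆ A ∪ U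
      B⊆A∪U x∈B with x∈p∪q⁻ (A +z) U (π⊆ F _ x∈B)
      ... | inj₂ x∈U = ∈∪ʳ x∈U
      ... | inj₁ x∈A+z with x∈p∪q⁻ A ⁅ z ⁆ x∈A+z
      ... | inj₁ x∈A = ∈∪ˡ x∈A
      ... | inj₂ x∈z with refl ← x∈⁅y⁆⇒x≡y z x∈z = contradiction x∈B z∉B
      π⊆ₐ : B ⊆ π F (A ∪ U)
      π⊆ₐ = ∈-π⁺ F (A ∪ U) B∈F B⊆A∪U

    mass-saturated : ∀ w → (∀ {A} → A ∈F K → w (A +z) ≡ w A) → mass w saturated ≡ mass w G + mass w K
    mass-saturated w w-+z = trans
      (mass-∪ᶠ w G (shift z K) λ {C} C∈ C∈G →
        let z∈C , C-z∈K = ∈-shift⁻ {G = K} C∈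
        in not⁻ {G ((C - z) +z)} (proj₂ (∧⁻ {G (C - z)} C-z∈K)) (subst (_∈F G) (sym (-∪⁅⁆ z∈C)) C∈G))
      (cong (_ +_) (trans (mass-shift w z {K} K-∌z) (mass-cong {G = K} w-+z)))

    weight-+z : ∀ {A} → A ∈F K → weight (A +z) ≡ weight A
    weight-+z {A} A∈K = e-cong-trace F U uc ⊥∈F {A +z} {A}
      (λ x∈ → proj₂ (∈─⁻ D U (∪-least (within A A∈G) (⁅⁆⊆ z∈D─U) x∈)))
      (within-avoids within A∈G) (trace-+z A∈K)
      where A∈G = proj₁ (∧⁻ {G A} A∈K)

    saturated-minimal : Minimal saturated
    saturated-minimal = minimal-≼ min (let A , A∈G = nonempty in A , G⊆saturated A∈G) saturated-absorbing
      (subst₂ (λ s c → s * size G ≤ mass weight G * c)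
        (sym (mass-saturated weight weight-+z)) (sym (mass-saturated (λ _ → 1) (λ _ → refl)))
        (begin
          (mass weight G + mass weight K) * size G                ≡⟨ *-distribʳ-+ (size G) (mass weight G) _ ⟩
          mass weight G * size G + mass weight K * size G         ≤⟨ +-monoʳ-≤ _ (complement-≼ (not ∘ old) (≼-all _ old-absorbing)) ⟩
          mass weight G * size G + mass weight G * size K         ≡⟨ *-distribˡ-+ (mass weight G) (size G) _ ⟨
          mass weight G * (size G + size K)                       ∎))
      where open ≤-Reasoning

  minimal-closed : ∀ zs → ∃ λ G → Minimal G × (∀ {z} → z ∈ˡ zs → z ∈ D ─ U → ∀ {A} → A ∈F G → (A ∪ ⁅ z ⁆) ∈F G)
  minimal-closed [] = let G , min = minimal-exists in G , min , λ ()
  minimal-closed (z ∷ zs) with minimal-closed zs | z ∈? D ─ U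
  ... | G , min , closed | no z∉ = G , min , λ { (here refl) z∈ → contradiction z∈ z∉ ; (there y∈) → closed y∈ }
  ... | G , min , closed | yes z∈ = saturated , saturated-minimal , λ
    { (here refl) _ → saturated-+z
    ; {y} (there y∈) y∈D─U → preserves (_∪ ⁅ y ⁆) (λ A → +z-∪ A ⁅ y ⁆) (closed y∈ y∈D─U)
    }
    where open Saturate min z∈

  minimal-upClosed : ∃ λ G → Minimal G × UpClosed G
  minimal-upClosed with minimal-closed (allFin n)
  ... | G , min , closed = G , min , λ A B → up A B (<-wellFounded _)
    where
    -- The points of `B ─ A` are added to `A` one at a time, by induction on their number.
    up : ∀ A B → Acc _<_ ∣ B ─ A ∣ → A ∈F G → A ⊆ B → B ⊆ D ─ U → B ∈F G
    up A B (acc rec) A∈G A⊆B B⊆ with nonempty? (B ─ A)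
    ... | yes (z , z∈B─A) = up (A ∪ ⁅ z ⁆) B
      (rec (subst (λ C → ∣ C ∣ < ∣ B ─ A ∣) (p─q─r≡p─q∪r B A ⁅ z ⁆) (x∈p⇒∣p-x∣<∣p∣ z∈B─A)))
      (closed (∈-allFin z) (B⊆ z∈B) A∈G) (∪-least A⊆B (⁅⁆⊆ z∈B)) B⊆
      where z∈B = proj₁ (∈─⁻ B A z∈B─A)
    ... | no empty = subst (_∈F G) (⊆-antisym A⊆B B⊆A) A∈G
      where
      B⊆A : B ⊆ A
      B⊆A {x} x∈B with x ∈? A
      ... | yes x∈A = x∈A
      ... | no x∉A = contradiction (x , ∈─⁺ x∈B x∉A) empty

  -- Moving the members of an up-set that miss z onto z keeps their weights and gives an
  -- up-set again, so they weigh at least the minimum on average and the members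
  -- containing z at most the minimum.
  module Pin {G : Family n} (min : Minimal G) (up : UpClosed G)
             {z : Fin n} (z∈D : z ∈ D) (z∉N² : z ∉ N²) where
    open Minimal min
    private
      within = proj₁ absorbing

      z∈D─U : z ∈ D ─ U
      z∈D─U = ∈─⁺ z∈D (z∉N² ∘ ⊆-Nbd F (Nbd F U) ∘ ⊆-Nbd F U)

    ∋z : Family n
    ∋z A = lookup A z

    pinned G₀ : Family n
    pinned A = G A ∧ ∋z A
    G₀ A = G A ∧ not (∋z A)

    pinned⁻ : ∀ {A} → A ∈F pinned → A ∈F G × z ∈ A
    pinned⁻ {A} A∈ = let A∈G , eq = ∧⁻ {G A} A∈ in A∈G , lookup⇒[]= z A eq

    pinned⁺ : ∀ {A} → A ∈F G → z ∈ A → A ∈F pinned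
    pinned⁺ {A} A∈G z∈A = ∧⁺ {G A} A∈G ([]=⇒lookup z∈A)

    G₀⁻ : ∀ {A} → A ∈F G₀ → A ∈F G × z ∉ A
    G₀⁻ {A} A∈ = let A∈G , eq = ∧⁻ {G A} A∈ in A∈G , not⁻ {lookup A z} eq ∘ []=⇒lookup

    G₀⁺ : ∀ {A} → A ∈F G → z ∉ A → A ∈F G₀
    G₀⁺ {A} A∈G z∉A = ∧⁺ {G A} A∈G (not⁺ {lookup A z} (z∉A ∘ lookup⇒[]= z A))

    pinned-within : Within pinned
    pinned-within A = within A ∘ proj₁ ∘ pinned⁻ {A}

    pinned-upClosed : UpClosed pinned
    pinned-upClosed A B A∈ A⊆B B⊆ = let A∈G , z∈A = pinned⁻ {A} A∈ in pinned⁺ (up A B A∈G A⊆B B⊆) (A⊆B z∈A)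

    moved : Family n
    moved = shift z G₀

    -- `G₀` itself need not be absorbing, since some `A ─ U` may bring in `z`. Once `z` lies in
    -- every set, enlarging a set cannot leave the family.
    moved-absorbing : Absorbing moved
    moved-absorbing = upClosed⇒absorbing within′ up′
      where
      within′ : Within moved
      within′ A A∈ = let z∈A , A-z∈ = ∈-shift⁻ {G = G₀} A∈ in
        subst (_⊆ D ─ U) (-∪⁅⁆ z∈A) (∪-least (within _ (proj₁ (G₀⁻ {A - z} A-z∈))) (⁅⁆⊆ z∈D─U))
      up′ : UpClosed moved
      up′ A B A∈ A⊆B B⊆ =
        let z∈A , A-z∈ = ∈-shift⁻ {G = G₀} A∈
        in ∈-shift⁺ {G = G₀} (A⊆B z∈A) (G₀⁺
             (up (A - z) (B - z) (proj₁ (G₀⁻ {A - z} A-z∈))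
               (λ x∈ → let x∈A , x∉z = ∈─⁻ A ⁅ z ⁆ x∈ in ∈─⁺ (A⊆B x∈A) x∉z)
               (⊆-trans (p─q⊆p B ⁅ z ⁆) B⊆))
             (λ z∈B-z → proj₂ (∈─⁻ B ⁅ z ⁆ z∈B-z) (x∈⁅x⁆ z)))

    mass-moved : ∀ w → (∀ {A} → A ∈F G₀ → w (A ∪ ⁅ z ⁆) ≡ w A) → mass w moved ≡ mass w G₀
    mass-moved w w-z = trans (mass-shift w z {G₀} (λ {A} → proj₂ ∘ G₀⁻ {A})) (mass-cong {G = G₀} w-z)

    G≼G₀ : G ≼ G₀
    G≼G₀ = subst₂ (λ s c → mass weight G * c ≤ s * size G)
      (mass-moved weight λ {A} A∈ → e-beyond-N² F U uc ⊥∈F {A} (within-avoids within (proj₁ (G₀⁻ {A} A∈))) z∉N²)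
      (mass-moved (λ _ → 1) λ _ → refl)
      (≼-all moved moved-absorbing)

    pinned-minimal : Minimal pinned
    pinned-minimal = minimal-≼ min
      (let A , A∈G = nonempty in
        A ∪ ⁅ z ⁆ , pinned⁺ (up A _ A∈G ∈∪ˡ (∪-least (within A A∈G) (⁅⁆⊆ z∈D─U))) (∈∪ʳ (x∈⁅x⁆ z)))
      (upClosed⇒absorbing pinned-within pinned-upClosed)
      (complement-≼ ∋z G≼G₀)

  minimal-pinned : ∀ zs → ∃ λ G → Minimal G × UpClosed G ×
                   (∀ {z} → z ∈ˡ zs → z ∈ D → z ∉ N² → ∀ {A} → A ∈F G → z ∈ A)
  minimal-pinned [] = let G , min , up = minimal-upClosed in G , min , up , λ ()
  minimal-pinned (z ∷ zs) with minimal-pinned zs | z ∈? D | z ∈? N²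
  ... | G , min , up , pin | no z∉D | _ =
    G , min , up , λ { (here refl) z∈D → contradiction z∈D z∉D ; (there y∈) → pin y∈ }
  ... | G , min , up , pin | yes _ | yes z∈N² =
    G , min , up , λ { (here refl) _ z∉N² → contradiction z∈N² z∉N² ; (there y∈) → pin y∈ }
  ... | G , min , up , pin | yes z∈D | no z∉N² = pinned , pinned-minimal , pinned-upClosed , λ
    { (here refl) _ _ {A} A∈ → proj₂ (pinned⁻ {A} A∈)
    -- Points pinned earlier stay pinned, as `pinned` is a subfamily of `G`.
    ; (there y∈) y∈D y∉N² {A} A∈ → pin y∈ y∈D y∉N² (proj₁ (pinned⁻ {A} A∈))
    }
    where open Pin min up z∈D z∉N²

  -- Extensions and absorbing families

  -- Removing `U` commutes with unions, so both closure properties can be checked in `F ∨ H`, where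
  -- a further member of `F` merges with the component from `F`.
  extension-absorbing : ∀ {H} → ExtFamily U H → ⋃ (F ∨ H) ⊆ D → Absorbing ((F ∨ H) ∖ U)
  extension-absorbing {H} (_ , H-uc , H#U) F′⊆D = within , join , absorbs
    where
    F′ = F ∨ H
    within : Within (F′ ∖ U)
    within C C∈ with ∈-∖⁻ F′ U C∈
    ... | A , A∈ , refl = λ x∈ → let x∈A , x∉U = ∈─⁻ A U x∈ in ∈─⁺ (F′⊆D (∈-⋃⁺ F′ A∈ x∈A)) x∉U
    ─-∪ : ∀ A B → (A ∪ B) ─ U ≡ (A ─ U) ∪ (B ─ U)
    ─-∪ A B = ⊆-antisym
      (λ x∈ → let x∈∪ , x∉U = ∈─⁻ (A ∪ B) U x∈ in
        [ (λ x∈A → ∈∪ˡ (∈─⁺ x∈A x∉U)) , (λ x∈B → ∈∪ʳ (∈─⁺ x∈B x∉U)) ]′ (x∈p∪q⁻ A B x∈∪))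
      (∪-least (λ x∈ → let x∈A , x∉U = ∈─⁻ A U x∈ in ∈─⁺ (∈∪ˡ x∈A) x∉U)
               (λ x∈ → let x∈B , x∉U = ∈─⁻ B U x∈ in ∈─⁺ (∈∪ʳ x∈B) x∉U))
    join′ : UnionClosed F′
    join′ A B A∈ B∈ with ∈-∨⁻ F H A∈ | ∈-∨⁻ F H B∈
    ... | A₁ , A₂ , A₁∈ , A₂∈ , refl | B₁ , B₂ , B₁∈ , B₂∈ , refl =
      subst (_∈F F′) (∪-interchange A₁ B₁ A₂ B₂) (∈-∨⁺ F H (uc A₁ B₁ A₁∈ B₁∈) (H-uc A₂ B₂ A₂∈ B₂∈))
      where
      ∪-interchange : ∀ A B C E → (A ∪ B) ∪ (C ∪ E) ≡ (A ∪ C) ∪ (B ∪ E)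
      ∪-interchange A B C E = begin
        (A ∪ B) ∪ (C ∪ E)   ≡⟨ ∪-assoc A B _ ⟩
        A ∪ (B ∪ (C ∪ E))   ≡⟨ cong (A ∪_) (∪-assoc B C E) ⟨
        A ∪ ((B ∪ C) ∪ E)   ≡⟨ cong (λ X → A ∪ (X ∪ E)) (∪-comm B C) ⟩
        A ∪ ((C ∪ B) ∪ E)   ≡⟨ cong (A ∪_) (∪-assoc C B E) ⟩
        A ∪ (C ∪ (B ∪ E))   ≡⟨ ∪-assoc A C _ ⟨
        (A ∪ C) ∪ (B ∪ E)   ∎
        where open ≡-Reasoning
    join : UnionClosed (F′ ∖ U)
    join A B A∈ B∈ with ∈-∖⁻ F′ U A∈ | ∈-∖⁻ F′ U B∈
    ... | A′ , A′∈ , refl | B′ , B′∈ , refl =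
      subst (_∈F (F′ ∖ U)) (─-∪ A′ B′) (∈-∖⁺ F′ U (join′ A′ B′ A′∈ B′∈))
    absorbs : Absorbs (F′ ∖ U)
    absorbs A B A∈F B∈ with ∈-∖⁻ F′ U B∈
    ... | B′ , B′∈ , refl with ∈-∨⁻ F H B′∈
    ... | B₁ , B₂ , B₁∈ , B₂∈ , refl = subst (_∈F (F′ ∖ U)) (─-∪ A (B₁ ∪ B₂))
      (∈-∖⁺ F′ U (subst (_∈F F′) (∪-assoc A B₁ B₂) (∈-∨⁺ F H (uc A B₁ A∈F B₁∈) B₂∈)))

  extension-nonempty : ∀ {H} → NonemptyFamily H → NonemptyFamily ((F ∨ H) ∖ U)
  extension-nonempty {H} (B , B∈H) = _ , ∈-∖⁺ (F ∨ H) U (∈-∨⁺ F H ⊥∈F B∈H)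

  -- Members of `G` avoid `U`, so removing `U` from `A ∪ B` leaves `(A ─ U) ∪ B`, which `G` absorbs.
  -- Conversely, taking `A = ⊥` recovers every member of `G`.
  absorbing-extension : ∀ {G} → Absorbing G → ∀ C → ((F ∨ G) ∖ U) C ≡ G C
  absorbing-extension {G} (within , join , absorbs) C = ⇔→≡ (mk⇔ fwd bwd)
    where
    avoid : ∀ {B} → B ∈F G → ∀ A → (A ∪ B) ─ U ≡ (A ─ U) ∪ B
    avoid {B} B∈G A = ⊆-antisym
      (λ x∈ → let x∈∪ , x∉U = ∈─⁻ (A ∪ B) U x∈ in [ (λ x∈A → ∈∪ˡ (∈─⁺ x∈A x∉U)) , ∈∪ʳ ]′ (x∈p∪q⁻ A B x∈∪))
      (∪-least (λ x∈ → let x∈A , x∉U = ∈─⁻ A U x∈ in ∈─⁺ (∈∪ˡ x∈A) x∉U)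
               (λ x∈B → ∈─⁺ (∈∪ʳ x∈B) (within-avoids within B∈G x∈B)))
    fwd : C ∈F ((F ∨ G) ∖ U) → C ∈F G
    fwd C∈ with ∈-∖⁻ (F ∨ G) U C∈
    ... | C′ , C′∈ , refl with ∈-∨⁻ F G C′∈
    ... | A , B , A∈F , B∈G , refl = subst (_∈F G) (sym (avoid B∈G A)) (absorbs A B A∈F B∈G)
    bwd : C ∈F G → C ∈F ((F ∨ G) ∖ U)
    bwd C∈G = subst (_∈F ((F ∨ G) ∖ U)) C≡ (∈-∖⁺ (F ∨ G) U (∈-∨⁺ F G ⊥∈F C∈G))
      where
      C≡ : (⊥ ∪ C) ─ U ≡ C
      C≡ = ⊆-antisym
        (λ x∈ → subst (_ ∈_) (∪-identityˡ C) (proj₁ (∈─⁻ (⊥ ∪ C) U x∈)))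
        (λ x∈C → ∈─⁺ (∈∪ʳ x∈C) (within-avoids within C∈G x∈C))

  μ≡frac : ∀ H → μ F U (F ∨ H) ≡ frac {n} (mass weight ((F ∨ H) ∖ U)) (size ((F ∨ H) ∖ U))
  μ≡frac H = cong₂ (frac {n}) (sum-members weight ((F ∨ H) ∖ U)) (card≡size ((F ∨ H) ∖ U))

theorem3p17 : (n : ℕ) (F : Family n) (U D : Subset n) →
    UnionClosed F → ⊥ ∈F F → U ⊆ ⋃ F → ⋃ F ⊆ D →
    Σ (Family n) λ H →
    ExtFamily U H
    × NonemptyUpSetOf (D ─ U) H
    × (∀ C → ((F ∨ H) ∖ U) C ≡ H C)
    × MinimizesμIn F U D H
    × (∀ C → ((F ∨ H) ∖ Nbd F (Nbd F U)) C ≡ (C == (D ─ Nbd F (Nbd F U))))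
theorem3p17 n F U D uc ⊥∈F _ ⋃F⊆D = H
  , (nonempty , proj₁ (proj₂ absorbing) , ⋃H#U)
  , (nonempty , within , up)
  , F′∖U≗H
  , (F′⊆D , minimizes)
  , λ C → ⇔→≡ (mk⇔ (fwd C) (bwd C))
  where
  open Minimizers F U D uc ⊥∈F ⋃F⊆D
  result = minimal-pinned (allFin n)
  H = proj₁ result
  up = proj₁ (proj₂ (proj₂ result))
  open Minimal (proj₁ (proj₂ result))
  within = proj₁ absorbing
  F′∖U≗H = absorbing-extension absorbing

  D─N²⊆ : ∀ {A} → A ∈F H → D ─ N² ⊆ A
  D─N²⊆ A∈H x∈ = let x∈D , x∉N² = ∈─⁻ D N² x∈ in proj₂ (proj₂ (proj₂ result)) (∈-allFin _) x∈D x∉N² A∈H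

  ⋃H#U : Disjoint (⋃ H) U
  ⋃H#U = ≡⊥ λ x∈ →
    let x∈⋃ , x∈U = x∈p∩q⁻ (⋃ H) U x∈
        A , A∈H , x∈A = ∈-⋃⁻ H x∈⋃
    in within-avoids within A∈H x∈A x∈U

  member⊆D′ : ∀ {A} → A ∈F (F ∨ H) → A ⊆ D
  member⊆D′ A∈ with ∈-∨⁻ F H A∈
  ... | A , B , A∈F , B∈H , refl = ∪-least (member⊆D A∈F) (⊆-trans (within B B∈H) (p─q⊆p D U))

  F′⊆D : ⋃ (F ∨ H) ⊆ D
  F′⊆D x∈ = let A , A∈ , x∈A = ∈-⋃⁻ (F ∨ H) x∈ in member⊆D′ A∈ x∈A

  minimizes : ∀ H″ → ExtFamily U H″ → ⋃ (F ∨ H″) ⊆ D → μ F U (F ∨ H) ℚ.≤ μ F U (F ∨ H″)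
  minimizes H″ ext ⊆D = subst₂ ℚ._≤_ (sym (μ≡frac H)) (sym (μ≡frac H″))
    (subst₂ (λ s c → frac {n} s c ℚ.≤ frac {n} (mass weight G″) (size G″))
      (sym (mass-congᶠ weight F′∖U≗H)) (sym (mass-congᶠ (λ _ → 1) F′∖U≗H))
      -- Nonemptiness of both families keeps `frac` away from its default value 0.
      (frac-mono {n} (size>0 nonempty) (size>0 (extension-nonempty (proj₁ ext)))
        (≼-all G″ (extension-absorbing ext ⊆D))))
    where G″ = (F ∨ H″) ∖ U

  ─N²≡ : ∀ {A} → A ∈F (F ∨ H) → A ─ N² ≡ D ─ N²
  ─N²≡ {A} A∈ = ⊆-antisym
    (λ x∈ → let x∈A , x∉ = ∈─⁻ A N² x∈ in ∈─⁺ (member⊆D′ A∈ x∈A) x∉)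
    (λ x∈ → ∈─⁺ (D─N²⊆A (∈-∨⁻ F H A∈) x∈) (proj₂ (∈─⁻ D N² x∈)))
    where
    D─N²⊆A : (∃ λ B → ∃ λ C → B ∈F F × C ∈F H × B ∪ C ≡ A) → D ─ N² ⊆ A
    D─N²⊆A (B , C , _ , C∈H , refl) = ∈∪ʳ ∘ D─N²⊆ C∈H

  fwd : ∀ C → C ∈F ((F ∨ H) ∖ N²) → (C == (D ─ N²)) ≡ true
  fwd C C∈ = let A , A∈ , A─N²≡C = ∈-∖⁻ (F ∨ H) N² C∈ in ==⁺ (trans (sym A─N²≡C) (─N²≡ A∈))

  bwd : ∀ C → (C == (D ─ N²)) ≡ true → C ∈F ((F ∨ H) ∖ N²)
  bwd C eq =
    -- Any member of `H` serves as witness, since all members of the extension agree off `N²`.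
    let A , A∈H = nonempty
        A∈F′ = ∈-∨⁺ F H ⊥∈F A∈H
    in subst (_∈F ((F ∨ H) ∖ N²)) (trans (─N²≡ A∈F′) (sym (==⁻ {p = C} eq))) (∈-∖⁺ (F ∨ H) N² A∈F′)
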